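{- Let $T$ be a fixed edge-ordered tree. Then $sat_m(n,e_0+T)=O(1)$.
   Context: An edge-ordered graph is a finite simple graph together with a linear order on its edge set (usually given by an injective labeling $l:E\to\mathbb{N}$ or $l:E\to\mathbb{R}$). An edge-ordered graph $H$ contains $G$ (has a copy of $G$) if $G$ is isomorphic, by an isomorphism respecting the edge-order, to a subgraph of $H$ with the induced order; otherwise $H$ is $G$-free. An edge-ordered tree is an edge-ordered graph whose underlying graph is a tree. For an edge-ordered graph $G$, $e_0+G$ denotes the edge-ordered graph obtained from $G$ by adding a vertex-disjoint (isolated) edge $e_0$ whose label is smaller than all labels of $G$. $sat_m(n,G)$ is the minimum number of edges in a $G$-free edge-ordered graph $H$ on $n$ vertices such that adding to $H$ any missing edge, inserted at the beginning of the linear order (i.e. with a label smaller than all labels of $H$), creates a copy of $G$. Asymptotic notation is for $n\to\infty$ with $T$ fixed. -}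

module Defs where

open import Data.Fin using (Fin; zero; suc; inject₁; fromℕ; _<_; _↑ʳ_)
open import Data.Fin.Properties using (↑ʳ-injective)
open import Data.List using (List; _∷_; length; lookup; map)
open import Data.List.Membership.Propositional using (_∉_)
open import Data.List.Membership.Propositional.Properties using (∈-map⁻)
open import Data.List.Relation.Unary.All.Properties.Core using (¬Any⇒All¬)
open import Data.List.Relation.Unary.AllPairs using (_∷_)
open import Data.List.Relation.Unary.Unique.Propositional using (Unique)
open import Data.List.Relation.Unary.Unique.Propositional.Properties using (map⁺)
open import Data.Nat as ℕ using (ℕ; z≤n; s≤s)
open import Data.Product using (∃-syntax; _×_; _,_)
open import Data.Sum using (_⊎_)
open import Function.Definitions using (Injective)
open import Relation.Binary.Construct.Closure.ReflexiveTransitive using (Star)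
open import Relation.Binary.PropositionalEquality using (_≡_; refl; cong)
open import Relation.Nullary using (¬_)

-- An unordered pair of distinct vertices, stored with its smaller end first
-- so that propositional equality is equality of two-element sets.
record Edge (n : ℕ) : Set where
  constructor edge
  field
    lo hi  : Fin n
    .lo<hi : lo < hi

open Edge public

Joins : ∀ {n} → Edge n → Fin n → Fin n → Set
Joins e u v = (lo e ≡ u × hi e ≡ v) ⊎ (lo e ≡ v × hi e ≡ u)

-- A linear order on a finite edge set is the same thing as a repetition-free
-- list of the edges: the label of an edge is its position in the list.
record EdgeOrderedGraph (n : ℕ) : Set where
  constructor graph
  field
    edges  : List (Edge n)
    unique : Unique edges

open EdgeOrderedGraph public

size : ∀ {n} → EdgeOrderedGraph n → ℕ
size G = length (edges G)

Label : ∀ {n} → EdgeOrderedGraph n → Set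
Label G = Fin (size G)

edgeAt : ∀ {n} (G : EdgeOrderedGraph n) → Label G → Edge n
edgeAt G = lookup (edges G)

Adj : ∀ {n} → EdgeOrderedGraph n → Fin n → Fin n → Set
Adj G u v = ∃[ i ] Joins (edgeAt G i) u v

Connected : ∀ {n} → EdgeOrderedGraph n → Set
Connected {n} G = ∀ (u v : Fin n) → Star (Adj G) u v

-- A cycle through the 3 + k distinct vertices c 0, c 1, …, c (2 + k).
IsCycle : ∀ {n} → EdgeOrderedGraph n → ∀ k → (Fin (3 ℕ.+ k) → Fin n) → Set
IsCycle G k c =
  Injective _≡_ _≡_ c ×
  (∀ (i : Fin (2 ℕ.+ k)) → Adj G (c (inject₁ i)) (c (suc i))) ×
  Adj G (c (fromℕ (2 ℕ.+ k))) (c zero)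

Acyclic : ∀ {n} → EdgeOrderedGraph n → Set
Acyclic G = ¬ (∃[ k ] ∃[ c ] IsCycle G k c)

IsTree : ∀ {n} → EdgeOrderedGraph n → Set
IsTree {n} G = 1 ℕ.≤ n × Connected G × Acyclic G

record Copy {m n : ℕ} (G : EdgeOrderedGraph m) (H : EdgeOrderedGraph n) : Set where
  field
    onVertex         : Fin m → Fin n
    onVertex-inj     : Injective _≡_ _≡_ onVertex
    onLabel          : Label G → Label H
    preserves-ends   : ∀ i → Joins (edgeAt H (onLabel i))
                                   (onVertex (lo (edgeAt G i)))
                                   (onVertex (hi (edgeAt G i)))
    preserves-order  : ∀ {i j} → i < j → onLabel i < onLabel j

_contains_ : ∀ {m n} → EdgeOrderedGraph n → EdgeOrderedGraph m → Set
H contains G = Copy G H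

_isFreeOf_ : ∀ {m n} → EdgeOrderedGraph n → EdgeOrderedGraph m → Set
H isFreeOf G = ¬ (H contains G)

addFirst : ∀ {n} (H : EdgeOrderedGraph n) (e : Edge n) → e ∉ edges H →
           EdgeOrderedGraph n
addFirst H e e∉H = graph (e ∷ edges H) (¬Any⇒All¬ (edges H) e∉H ∷ unique H)

shiftEdge : ∀ {n} → Edge n → Edge (2 ℕ.+ n)
shiftEdge (edge u v u<v) = edge (2 ↑ʳ u) (2 ↑ʳ v) (s≤s (s≤s u<v))

shiftEdge-injective : ∀ {n} {e f : Edge n} → shiftEdge e ≡ shiftEdge f → e ≡ f
shiftEdge-injective {e = edge u v _} {edge u′ v′ _} eq
  with ↑ʳ-injective 2 u u′ (cong lo eq) | ↑ʳ-injective 2 v v′ (cong hi eq)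
... | refl | refl = refl

shift : ∀ {n} → EdgeOrderedGraph n → EdgeOrderedGraph (2 ℕ.+ n)
shift G = graph (map shiftEdge (edges G)) (map⁺ shiftEdge-injective (unique G))

e₀ : ∀ {n} → Edge (2 ℕ.+ n)
e₀ = edge zero (suc zero) (s≤s z≤n)

e₀∉shift : ∀ {n} (G : EdgeOrderedGraph n) → e₀ ∉ edges (shift G)
e₀∉shift G e₀∈ with ∈-map⁻ shiftEdge e₀∈
... | edge _ _ _ , _ , ()

e₀+_ : ∀ {n} → EdgeOrderedGraph n → EdgeOrderedGraph (2 ℕ.+ n)
e₀+ G = addFirst (shift G) e₀ (e₀∉shift G)

Saturated : ∀ {m n} → EdgeOrderedGraph m → EdgeOrderedGraph n → Set
Saturated {n = n} G H =
  H isFreeOf G ×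
  (∀ (e : Edge n) (e∉H : e ∉ edges H) → addFirst H e e∉H contains G)

-- The relation "satₘ(n , G) = k".
IsSatₘ : ∀ {m} → ℕ → EdgeOrderedGraph m → ℕ → Set
IsSatₘ n G k =
  (∃[ H ] Saturated {n = n} G H × size H ≡ k) ×
  (∀ (H : EdgeOrderedGraph n) → Saturated G H → k ℕ.≤ size H)

{-# OPTIONS --safe #-}
module Submission where

-- Contract the first edge of T and join the contracted vertices of three disjoint copies of the
-- result by a triangle whose edges come first in the order. A copy of T that avoids the triangle
-- lies in one fibre, which has a vertex too few; a copy that meets the triangle starts in it, so an
-- earlier edge also lies in the triangle and meets the first edge of the copy: the graph is
-- free of e₀ + T. As T without its first edge splits into two sides, each triangle edge starts a
-- copy of T that avoids the opposite fibre. Hence every new edge with an end outside the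
-- bounded set covered by the three fibres creates e₀ + T, and adding edges greedily inside
-- this set produces a saturated graph of bounded size.

open import Defs
open import Data.Bool using (Bool; true; false; if_then_else_)
open import Data.Fin as Fin
  using (Fin; zero; suc; toℕ; fromℕ; fromℕ<; inject₁; inject≤; combine; punchOut; _↑ʳ_)
open import Data.Fin.Properties as Fin using ()
open import Data.List using (List; []; _∷_; [_]; _++_; length; lookup; map; allFin; cartesianProductWith)
import Data.List.Membership.DecPropositional as DecMembership
open import Data.List.Membership.Propositional using (_∈_; _∉_; find; lose)
open import Data.List.Membership.Propositional.Properties
  using (∈-map⁺; ∈-map⁻; ∈-lookup; ∈-++⁺ˡ; ∈-++⁺ʳ; ∈-allFin;
         ∈-cartesianProductWith⁺; ∈-cartesianProductWith⁻)
open import Data.List.Properties using (length-map)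
open import Data.List.Relation.Binary.Pointwise using (Pointwise; []; _∷_)
import Data.List.Relation.Binary.Sublist.Heterogeneous as Sublist
open import Data.List.Relation.Binary.Sublist.Heterogeneous using (Sublist; []; _∷_; _∷ʳ_; minimum; fromAny)
open import Data.List.Relation.Binary.Sublist.Heterogeneous.Properties using (++⁺; ∷ˡ⁻; sublist?; trans)
open import Data.List.Relation.Binary.Sublist.Propositional using (_⊆_; ⊆-refl; ⊆-trans)
import Data.List.Relation.Binary.Sublist.Propositional as ⊆
open import Data.List.Relation.Unary.All as All using (All; []; _∷_)
open import Data.List.Relation.Unary.All.Properties.Core using (¬Any⇒All¬)
open import Data.List.Relation.Unary.AllPairs using ([]; _∷_)
open import Data.List.Relation.Unary.Any as Any using (Any; here; there)
import Data.List.Relation.Unary.Any.Properties as Any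
open import Data.List.Relation.Unary.Unique.Propositional using (Unique)
import Data.List.Relation.Unary.Unique.Propositional.Properties as Unique
import Data.List.Relation.Unary.Unique.DecPropositional as DecUnique
open import Data.Nat as ℕ using (ℕ; zero; suc; _+_; _*_; _≤_; z≤n; s≤s; s<s⁻¹)
import Data.Nat.Properties as ℕ
open import Data.Product using (Σ-syntax; ∃; ∃-syntax; _×_; _,_; proj₁; proj₂)
open import Data.Sum using (_⊎_; inj₁; inj₂; [_,_]′)
open import Data.Vec as Vec using (Vec; toList; fromList; tabulate)
import Data.Vec.Properties as Vec
open import Function using (_∘_; id)
open import Function.Definitions using (Injective)
open import Level using (0ℓ)
open import Relation.Binary.Construct.Closure.ReflexiveTransitive as Star using (Star; ε; _◅_; _◅◅_)
open import Relation.Binary.Core using (REL; Rel)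
open import Relation.Binary.Definitions using (DecidableEquality; tri<; tri≈; tri>)
open import Relation.Binary.PropositionalEquality as ≡ using (_≡_; _≢_; refl; sym; cong; cong₂; subst; subst₂)
open import Relation.Nullary using (¬_; Dec; yes; no; does; contradiction; contradiction-irr)
open import Relation.Nullary.Decidable using (map′; _×-dec_; _⊎-dec_; _→-dec_; ¬?; from-yes; dec-true; dec-false)
open import Relation.Unary using (Decidable)

-- Finite search

record Listed (A : Set) : Set where
  field
    elements : List A
    complete : ∀ x → x ∈ elements

  any? : {P : A → Set} → Decidable P → Dec (∃ P)
  any? P? = map′ Any.satisfied (λ (x , px) → lose (complete x) px) (Any.any? P? elements)

  all? : {P : A → Set} → Decidable P → Dec (∀ x → P x)
  all? P? = map′ (λ ps x → All.lookup ps (complete x)) (λ p → All.universal p elements)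
                 (All.all? P? elements)

open Listed

Fin-listed : ∀ n → Listed (Fin n)
Fin-listed n = record { elements = allFin n ; complete = ∈-allFin }

Vec-listed : ∀ {A} → Listed A → ∀ k → Listed (Vec A k)
Vec-listed {A} L k = record { elements = vectors k ; complete = vectors-complete }
  where
  vectors : ∀ k → List (Vec A k)
  vectors zero    = [ Vec.[] ]
  vectors (suc k) = cartesianProductWith Vec._∷_ (elements L) (vectors k)

  vectors-complete : ∀ {k} (v : Vec A k) → v ∈ vectors k
  vectors-complete Vec.[]       = here refl
  vectors-complete (x Vec.∷ xs) =
    ∈-cartesianProductWith⁺ Vec._∷_ (complete L x) (vectors-complete xs)

sucEdge : ∀ {n} → Edge n → Edge (suc n)
sucEdge (edge u v u<v) = edge (suc u) (suc v) (s≤s u<v)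

allEdges : ∀ n → List (Edge n)
allEdges zero    = []
allEdges (suc n) = map (λ v → edge zero (suc v) (s≤s z≤n)) (allFin n) ++ map sucEdge (allEdges n)

∈-allEdges : ∀ {n} (e : Edge n) → e ∈ allEdges n
∈-allEdges {suc n} (edge zero (suc v) _) = ∈-++⁺ˡ (∈-map⁺ _ (∈-allFin v))
∈-allEdges {suc n} (edge (suc u) (suc v) u<v) =
  ∈-++⁺ʳ (map _ (allFin n)) (∈-map⁺ sucEdge (∈-allEdges (edge u v (s<s⁻¹ u<v))))

Edge-listed : ∀ n → Listed (Edge n)
Edge-listed n = record { elements = allEdges n ; complete = ∈-allEdges }

least : {P : ℕ → Set} → Decidable P → ∀ k → P k → ∃[ j ] (P j × j ≤ k × (∀ i → P i → j ≤ i))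
least {P} P? zero    p = 0 , p , z≤n , λ _ _ → z≤n
least {P} P? (suc k) p with P? 0
... | yes p₀ = 0 , p₀ , z≤n , λ _ _ → z≤n
... | no ¬p₀ with j , pj , j≤k , min ← least (P? ∘ suc) k p =
  suc j , pj , s≤s j≤k , λ where
    zero    p₀ → contradiction p₀ ¬p₀
    (suc i) pi → s≤s (min i pi)

edge-≡ : ∀ {n} {e f : Edge n} → lo e ≡ lo f → hi e ≡ hi f → e ≡ f
edge-≡ refl refl = refl

_≟ᴱ_ : ∀ {n} → DecidableEquality (Edge n)
e ≟ᴱ f = map′ (λ (p , q) → edge-≡ p q) (λ e≡f → cong lo e≡f , cong hi e≡f)
              (lo e Fin.≟ lo f ×-dec hi e Fin.≟ hi f)

not-reversed : ∀ {n} (e f : Edge n) → lo e ≡ hi f → hi e ≢ lo f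
not-reversed (edge _ _ u<v) (edge _ _ v<u) refl refl =
  contradiction-irr u<v (λ u<v → contradiction-irr v<u (ℕ.<-asym u<v))

lo≢hi : ∀ {n} (e : Edge n) → lo e ≢ hi e
lo≢hi (edge _ _ u<u) refl = contradiction-irr u<u (ℕ.<-irrefl refl)

Joins? : ∀ {n} (e : Edge n) u v → Dec (Joins e u v)
Joins? e u v = (lo e Fin.≟ u ×-dec hi e Fin.≟ v) ⊎-dec (lo e Fin.≟ v ×-dec hi e Fin.≟ u)

joining : ∀ {n} {u v : Fin n} → u ≢ v → ∃[ e ] Joins e u v
joining {u = u} {v} u≢v with Fin.<-cmp u v
... | tri< u<v _ _ = edge u v u<v , inj₁ (refl , refl)
... | tri≈ _ u≡v _ = contradiction u≡v u≢v
... | tri> _ _ v<u = edge v u v<u , inj₂ (refl , refl)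

On : ∀ {n} → Fin n → Edge n → Set
On x e = lo e ≡ x ⊎ hi e ≡ x

on-joined : ∀ {n} {e : Edge n} {u v x} → Joins e u v → On x e → x ≡ u ⊎ x ≡ v
on-joined (inj₁ (refl , refl)) (inj₁ refl) = inj₁ refl
on-joined (inj₁ (refl , refl)) (inj₂ refl) = inj₂ refl
on-joined (inj₂ (refl , refl)) (inj₁ refl) = inj₂ refl
on-joined (inj₂ (refl , refl)) (inj₂ refl) = inj₁ refl

Meet : ∀ {n} → Edge n → Edge n → Set
Meet e f = ∃[ x ] (On x e × On x f)

-- Two pairs among three vertices overlap; evaluation checks all cases. Because of this, disjoint
-- edges such as the first two of `e₀+ T` cannot both lie in a triangle.
edges₃-meet : (e f : Edge 3) → Meet e f
edges₃-meet = from-yes (all? (Edge-listed 3) λ e → all? (Edge-listed 3) λ f →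
  any? (Fin-listed 3) λ x → on? x e ×-dec on? x f)
  where
  on? : (x : Fin 3) (e : Edge 3) → Dec (On x e)
  on? x e = lo e Fin.≟ x ⊎-dec hi e Fin.≟ x

-- Copies as sublists

module _ {A B : Set} {R : REL A B 0ℓ} where

  position : ∀ {as bs} → Sublist R as bs → Fin (length as) → Fin (length bs)
  position (_ ∷ʳ s) i       = suc (position s i)
  position (_ ∷ s)  zero    = zero
  position (_ ∷ s)  (suc i) = suc (position s i)

  position-mono : ∀ {as bs} (s : Sublist R as bs) {i j} → i Fin.< j →
                  position s i Fin.< position s j
  position-mono (_ ∷ʳ s) i<j = s≤s (position-mono s i<j)
  position-mono (_ ∷ s) {zero}  {suc j} _         = s≤s z≤n
  position-mono (_ ∷ s) {suc i} {suc j} (s≤s i<j) = s≤s (position-mono s i<j)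

  position-related : ∀ {as bs} (s : Sublist R as bs) i →
                     R (lookup as i) (lookup bs (position s i))
  position-related (_ ∷ʳ s) i       = position-related s i
  position-related (r ∷ s)  zero    = r
  position-related (r ∷ s)  (suc i) = position-related s i

  private
    lower : ∀ {n} (x : Fin (suc n)) → zero {n} Fin.< x → ∃[ y ] x ≡ suc y
    lower (suc y) _ = y , refl

  fromPositions : ∀ as bs (φ : Fin (length as) → Fin (length bs)) →
                  (∀ {i j} → i Fin.< j → φ i Fin.< φ j) →
                  (∀ i → R (lookup as i) (lookup bs (φ i))) → Sublist R as bs
  -- The case where `φ` misses position zero: all positions are lowered by one and the head `b` is
  -- dropped, so the mutual recursion descends along the target list.
  afterHead : ∀ as b bs (φ : Fin (length as) → Fin (length (b ∷ bs))) →
              (∀ i → zero {length bs} Fin.< φ i) →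
              (∀ {i j} → i Fin.< j → φ i Fin.< φ j) →
              (∀ i → R (lookup as i) (lookup (b ∷ bs) (φ i))) → Sublist R as bs

  fromPositions []       bs       φ mono rel = minimum bs
  fromPositions (a ∷ as) []       φ mono rel with () ← φ zero
  fromPositions (a ∷ as) (b ∷ bs) φ mono rel with φ zero in φ₀
  ... | zero  = subst (λ x → R a (lookup (b ∷ bs) x)) φ₀ (rel zero) ∷
                afterHead as b bs (φ ∘ suc)
                  (λ i → subst (Fin._< φ (suc i)) φ₀ (mono (s≤s z≤n)))
                  (λ i<j → mono (s≤s i<j)) (rel ∘ suc)
  ... | suc y = b ∷ʳ afterHead (a ∷ as) b bs φ positive mono rel
    where
    positive : ∀ i → zero {length bs} Fin.< φ i
    positive zero    = subst (zero {length bs} Fin.<_) (sym φ₀) (s≤s z≤n)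
    positive (suc i) = ℕ.<-trans (positive zero) (mono (s≤s z≤n))

  afterHead as b bs φ positive mono rel = fromPositions as bs
    (λ i → proj₁ (lowered i))
    (λ {i} {j} i<j → s<s⁻¹ (subst₂ Fin._<_ (proj₂ (lowered i)) (proj₂ (lowered j)) (mono i<j)))
    (λ i → subst (λ x → R (lookup as i) (lookup (b ∷ bs) x)) (proj₂ (lowered i)) (rel i))
    where
    lowered : ∀ i → ∃[ y ] φ i ≡ suc y
    lowered i = lower (φ i) (positive i)

  -- Positions increase along the embedding, so once the head lands beyond `cs`, everything does.
  splitHead : ∀ {a as bs} cs → Sublist R (a ∷ as) (cs ++ bs) →
              Any (R a) cs ⊎ Sublist R (a ∷ as) bs
  splitHead []       s        = inj₂ s
  splitHead (c ∷ cs) (r ∷ s)  = inj₁ (here r)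
  splitHead (c ∷ cs) (_ ∷ʳ s) = [ inj₁ ∘ there , inj₂ ]′ (splitHead cs s)

JoinsVia : ∀ {m n} → (Fin m → Fin n) → Edge m → Edge n → Set
JoinsVia f e e′ = Joins e′ (f (lo e)) (f (hi e))

-- An increasing label map that respects ends amounts to a sublist embedding. In this form
-- containment is decidable for a fixed vertex map and monotone under `⊆`.
_Hosts_via_ : ∀ {m n} → List (Edge n) → List (Edge m) → (Fin m → Fin n) → Set
bs Hosts as via f = Injective _≡_ _≡_ f × Sublist (JoinsVia f) as bs

_Hosts_ : ∀ {m n} → List (Edge n) → List (Edge m) → Set
bs Hosts as = ∃[ f ] (bs Hosts as via f)

hosts⇒copy : ∀ {m n} {G : EdgeOrderedGraph m} {H : EdgeOrderedGraph n} →
             edges H Hosts edges G → Copy G H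
hosts⇒copy (f , f-inj , s) = record
  { onVertex        = f
  ; onVertex-inj    = f-inj
  ; onLabel         = position s
  ; preserves-ends  = position-related s
  ; preserves-order = position-mono s
  }

copy⇒hosts : ∀ {m n} {G : EdgeOrderedGraph m} {H : EdgeOrderedGraph n} →
             Copy G H → edges H Hosts edges G
copy⇒hosts c = onVertex , onVertex-inj , fromPositions _ _ onLabel preserves-order preserves-ends
  where open Copy c

hosts-mono : ∀ {m n} {as : List (Edge m)} {bs cs : List (Edge n)} →
             bs ⊆ cs → bs Hosts as → cs Hosts as
hosts-mono bs⊆cs (f , f-inj , s) = f , f-inj , trans (λ { r refl → r }) s bs⊆cs

-- Vectors stand in for vertex maps because they can be enumerated. A map and its tabulation agree
-- only pointwise, hence the transport along `lookup∘tabulate`.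
hosts? : ∀ {m n} (bs : List (Edge n)) (as : List (Edge m)) → Dec (bs Hosts as)
hosts? {m} {n} bs as = map′
  (λ (v , p) → Vec.lookup v , p)
  (λ (f , f-inj , s) → tabulate f ,
     (λ {x} {y} eq → f-inj (subst₂ _≡_ (Vec.lookup∘tabulate f x) (Vec.lookup∘tabulate f y) eq)) ,
     Sublist.map
       (λ {e} {e′} → subst₂ (Joins e′) (sym (Vec.lookup∘tabulate f (lo e)))
                                        (sym (Vec.lookup∘tabulate f (hi e)))) s)
  (any? (Vec-listed (Fin-listed n) m) λ v →
     map′ (λ inj {x} {y} → inj x y) (λ inj x y → inj)
       (Fin.all? λ x → Fin.all? λ y → Vec.lookup v x Fin.≟ Vec.lookup v y →-dec x Fin.≟ y)
     ×-dec sublist? (λ e e′ → Joins? e′ _ _) as bs)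

-- Least size of a saturated graph

SaturatedList : ∀ {m n} → List (Edge m) → List (Edge n) → Set
SaturatedList as bs = ¬ (bs Hosts as) × (∀ e → e ∉ bs → (e ∷ bs) Hosts as)

saturatedList? : ∀ {m n} (as : List (Edge m)) (bs : List (Edge n)) → Dec (SaturatedList as bs)
saturatedList? {n = n} as bs = ¬? (hosts? bs as) ×-dec
  all? (Edge-listed n) λ e → ¬? (DecMembership._∈?_ _≟ᴱ_ e bs) →-dec hosts? (e ∷ bs) as

saturated⇒list : ∀ {m n} {G : EdgeOrderedGraph m} {H : EdgeOrderedGraph n} →
                 Saturated G H → SaturatedList (edges G) (edges H)
saturated⇒list (free , sat) = free ∘ hosts⇒copy , λ e e∉H → copy⇒hosts (sat e e∉H)

list⇒saturated : ∀ {m n} {G : EdgeOrderedGraph m} {H : EdgeOrderedGraph n} →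
                 SaturatedList (edges G) (edges H) → Saturated G H
list⇒saturated (free , sat) = free ∘ copy⇒hosts , λ e e∉H → hosts⇒copy (sat e e∉H)

-- For each `k` it is decidable by exhaustive search whether some saturated graph has `k` edges, so
-- a single saturated graph starts the search for the least such `k` and bounds it.
satₘ-exists : ∀ {m n} (G : EdgeOrderedGraph m) (H : EdgeOrderedGraph n) → Saturated G H →
              ∃[ k ] (IsSatₘ n G k × k ≤ size H)
satₘ-exists {n = n} G H sat =
  let k , (v , unq , satᵥ) , k≤ , min = least Attained? (size H) (attained H sat)
  in  k , ((graph (toList v) unq , list⇒saturated satᵥ , Vec.length-toList v) ,
           λ H′ sat′ → min (size H′) (attained H′ sat′)) , k≤
  where
  Attained : ℕ → Set
  Attained k = Σ[ v ∈ Vec (Edge n) k ] (Unique (toList v) × SaturatedList (edges G) (toList v))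

  Attained? : Decidable Attained
  Attained? k = any? (Vec-listed (Edge-listed n) k) λ v →
    DecUnique.unique? _≟ᴱ_ (toList v) ×-dec saturatedList? (edges G) (toList v)

  attained : ∀ H → Saturated G H → Attained (size H)
  attained H sat = fromList (edges H) ,
    subst (λ es → Unique es × SaturatedList (edges G) es) (sym (Vec.toList∘fromList (edges H)))
      (unique H , saturated⇒list sat)

-- Greedy saturation

injectEdge : ∀ {m n} → m ≤ n → Edge m → Edge n
injectEdge m≤n (edge u v u<v) = edge (inject≤ u m≤n) (inject≤ v m≤n)
  (subst₂ ℕ._<_ (sym (Fin.toℕ-inject≤ u m≤n)) (sym (Fin.toℕ-inject≤ v m≤n)) u<v)

injectEdge-surjective : ∀ {m n} (m≤n : m ≤ n) (e : Edge n) → toℕ (lo e) ℕ.< m → toℕ (hi e) ℕ.< m →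
                        ∃[ e′ ] e ≡ injectEdge m≤n e′
injectEdge-surjective m≤n (edge u v u<v) u<m v<m =
  edge (fromℕ< u<m) (fromℕ< v<m)
    (subst₂ ℕ._<_ (sym (Fin.toℕ-fromℕ< u<m)) (sym (Fin.toℕ-fromℕ< v<m)) u<v) ,
  edge-≡ (inject≤-fromℕ< u<m) (inject≤-fromℕ< v<m)
  where
  inject≤-fromℕ< : ∀ {x} (x<m : toℕ x ℕ.< _) → x ≡ inject≤ (fromℕ< x<m) m≤n
  inject≤-fromℕ< x<m = Fin.toℕ-injective
    (sym (≡.trans (Fin.toℕ-inject≤ (fromℕ< x<m) m≤n) (Fin.toℕ-fromℕ< x<m)))

-- Each candidate in `cs` is put first unless it is present or would create a copy. A rejected
-- candidate stays saturated: later insertions only enlarge the list behind it, so the copy it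
-- creates survives. At most one edge is added per candidate.
greedy : ∀ {m n} (as : List (Edge m)) (cs : List (Edge n)) (H : EdgeOrderedGraph n) →
         ¬ (edges H Hosts as) →
         ∃[ H′ ] (edges H ⊆ edges H′ × ¬ (edges H′ Hosts as) × size H′ ≤ length cs + size H ×
                  All (λ e → e ∉ edges H′ → (e ∷ edges H′) Hosts as) cs)
greedy as [] H free = H , ⊆-refl , free , ℕ.≤-refl , []
greedy as (c ∷ cs) H free with DecMembership._∈?_ _≟ᴱ_ c (edges H) | hosts? (c ∷ edges H) as
... | yes c∈H | _
  with H′ , H⊆H′ , free′ , size≤ , sat ← greedy as cs H free
  = H′ , H⊆H′ , free′ , ℕ.m≤n⇒m≤1+n size≤ ,
    (λ c∉H′ → contradiction (⊆.lookup H⊆H′ c∈H) c∉H′) ∷ sat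
... | no c∉H | yes hosts
  with H′ , H⊆H′ , free′ , size≤ , sat ← greedy as cs H free
  = H′ , H⊆H′ , free′ , ℕ.m≤n⇒m≤1+n size≤ , (λ _ → hosts-mono (refl ∷ H⊆H′) hosts) ∷ sat
... | no c∉H | no ¬hosts
  with H′ , cH⊆H′ , free′ , size≤ , sat ← greedy as cs (addFirst H c c∉H) ¬hosts
  = H′ , ⊆-trans (c ∷ʳ ⊆-refl) cH⊆H′ , free′ ,
    subst (size H′ ≤_) (ℕ.+-suc (length cs) (size H)) size≤ ,
    (λ c∉H′ → contradiction (⊆.lookup cH⊆H′ (here refl)) c∉H′) ∷ sat

-- The new edge precedes everything in `bs`, so it can play `e₀` for any copy of `T` that misses
-- both of its ends.
e₀-hosts : ∀ {t n} {T : EdgeOrderedGraph t} {bs : List (Edge n)} {f : Fin t → Fin n}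
           (e : Edge n) → bs Hosts edges T via f → (∀ w → f w ≢ lo e) → (∀ w → f w ≢ hi e) →
           (e ∷ bs) Hosts edges (e₀+ T)
e₀-hosts {t} {n} {T} {bs} {f} e (f-inj , s) f≢lo f≢hi = g , g-inj , inj₁ (refl , refl) ∷ shifted s
  where
  g : Fin (2 + t) → Fin n
  g zero          = lo e
  g (suc zero)    = hi e
  g (suc (suc w)) = f w

  g-inj : Injective _≡_ _≡_ g
  g-inj {zero}        {zero}        _  = refl
  g-inj {zero}        {suc zero}    eq = contradiction eq (lo≢hi e)
  g-inj {zero}        {suc (suc y)} eq = contradiction (sym eq) (f≢lo y)
  g-inj {suc zero}    {zero}        eq = contradiction (sym eq) (lo≢hi e)
  g-inj {suc zero}    {suc zero}    _  = refl
  g-inj {suc zero}    {suc (suc y)} eq = contradiction (sym eq) (f≢hi y)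
  g-inj {suc (suc x)} {zero}        eq = contradiction eq (f≢lo x)
  g-inj {suc (suc x)} {suc zero}    eq = contradiction eq (f≢hi x)
  g-inj {suc (suc x)} {suc (suc y)} eq = cong (2 ↑ʳ_) (f-inj eq)

  shifted : ∀ {as bs} → Sublist (JoinsVia f) as bs → Sublist (JoinsVia g) (map shiftEdge as) bs
  shifted []       = []
  shifted (b ∷ʳ s) = b ∷ʳ shifted s
  shifted (r ∷ s)  = r ∷ shifted s

-- A new edge with an end outside the first M vertices avoids some copy of T, whatever its other end.
record RobustCore {t} (T : EdgeOrderedGraph t) (M n : ℕ) : Set where
  field
    host   : EdgeOrderedGraph n
    free   : ¬ (edges host Hosts edges (e₀+ T))
    robust : ∀ v → ∃[ f ] (edges host Hosts edges T via f ×
                           (∀ w → toℕ (f w) ℕ.< M) × (∀ w → f w ≢ v))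

-- Edges inside the first `M` vertices are settled greedily, and their number does not depend on
-- `n`; all other missing edges are settled by robustness.
satₘ-bounded : ∀ {t} (T : EdgeOrderedGraph t) (M K : ℕ) →
  (∀ n → M ≤ n → Σ[ core ∈ RobustCore T M n ] size (RobustCore.host core) ≤ K) →
  ∃[ C ] ∃[ N ] (∀ n → N ≤ n → ∃[ k ] (IsSatₘ n (e₀+ T) k × k ≤ C))
satₘ-bounded T M K cores = length (allEdges M) + K , M , bound
  where
  bound : ∀ n → M ≤ n → ∃[ k ] (IsSatₘ n (e₀+ T) k × k ≤ length (allEdges M) + K)
  bound n M≤n with core , size≤K ← cores n M≤n
    with H , host⊆H , free , size≤ , sat ←
      greedy (edges (e₀+ T)) (map (injectEdge M≤n) (allEdges M))
             (RobustCore.host core) (RobustCore.free core)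
    = let k , isSat , k≤ = satₘ-exists (e₀+ T) H (list⇒saturated (free , saturated))
      in  k , isSat , ℕ.≤-trans k≤ (ℕ.≤-trans size≤
            (ℕ.+-mono-≤ (ℕ.≤-reflexive (length-map (injectEdge M≤n) (allEdges M))) size≤K))
    where
    open RobustCore core using (robust)

    beyond : ∀ {x y : Fin n} → toℕ x ℕ.< M → ¬ (toℕ y ℕ.< M) → x ≢ y
    beyond x<M y≮M refl = y≮M x<M

    saturated : ∀ e → e ∉ edges H → (e ∷ edges H) Hosts edges (e₀+ T)
    saturated e e∉H with toℕ (lo e) ℕ.<? M | toℕ (hi e) ℕ.<? M
    ... | yes lo<M | yes hi<M with e′ , refl ← injectEdge-surjective M≤n e lo<M hi<M =
      All.lookup sat (∈-map⁺ (injectEdge M≤n) (∈-allEdges e′)) e∉H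
    -- The copy stays below `M` and so misses the outer end by itself; robustness is spent on the
    -- other end.
    ... | no lo≮M | _ with f , hosts , f<M , f≢hi ← robust (hi e) =
      hosts-mono (refl ∷ host⊆H) (e₀-hosts {T = T} e hosts (λ w → beyond (f<M w) lo≮M) f≢hi)
    ... | yes _ | no hi≮M with f , hosts , f<M , f≢lo ← robust (lo e) =
      hosts-mono (refl ∷ host⊆H) (e₀-hosts {T = T} e hosts f≢lo (λ w → beyond (f<M w) hi≮M))

-- Removing an edge of a tree

-- This serves twice: to merge two component labels, and to identify the ends of a contracted edge.
identify : ∀ {n} → Fin n → Fin n → Fin n → Fin n
identify x y w = if does (w Fin.≟ x) then y else w

module _ {n} (x y : Fin n) where

  identify-source : identify x y x ≡ y
  identify-source with x Fin.≟ x
  ... | yes _  = refl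
  ... | no x≢x = contradiction refl x≢x

  identify-target : identify x y y ≡ y
  identify-target with y Fin.≟ x
  ... | yes _ = refl
  ... | no _  = refl

  identify-≢ : x ≢ y → ∀ w → x ≢ identify x y w
  identify-≢ x≢y w with w Fin.≟ x
  ... | yes _  = x≢y
  ... | no w≢x = w≢x ∘ sym

  identify-cases : ∀ {u v} → identify x y u ≡ identify x y v →
                   u ≡ v ⊎ (u ≡ x × v ≡ y) ⊎ (u ≡ y × v ≡ x)
  identify-cases {u} {v} eq with u Fin.≟ x | v Fin.≟ x
  ... | yes u≡x | yes v≡x = inj₁ (≡.trans u≡x (sym v≡x))
  ... | yes u≡x | no _    = inj₂ (inj₁ (u≡x , sym eq))
  ... | no _    | yes v≡x = inj₂ (inj₂ (eq , v≡x))
  ... | no _    | no _    = inj₁ eq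

AdjIn : ∀ {n} → List (Edge n) → Rel (Fin n) 0ℓ
AdjIn es u v = Any (λ e → Joins e u v) es

-- All labels start distinct, and each edge merges the labels of its ends. Explicit labels make it
-- decidable on which side of a removed edge a vertex lies.
components : ∀ {n} (es : List (Edge n)) →
  ∃[ comp ] (All (λ e → comp (lo e) ≡ comp (hi e)) es ×
             (∀ {u v : Fin n} → comp u ≡ comp v → Star (AdjIn es) u v))
components [] = id , [] , λ { refl → ε }
components {n} (e ∷ es) with comp , ok , walk ← components es = comp′ , ok′ , walk′
  where
  x = comp (hi e)
  y = comp (lo e)

  comp′ : Fin n → Fin n
  comp′ = identify x y ∘ comp

  ok′ : All (λ e → comp′ (lo e) ≡ comp′ (hi e)) (e ∷ es)
  ok′ = ≡.trans (identify-target x y) (sym (identify-source x y)) ∷ All.map (cong (identify x y)) ok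

  walk⁺ : ∀ {u v} → comp u ≡ comp v → Star (AdjIn (e ∷ es)) u v
  walk⁺ = Star.map there ∘ walk

  walk′ : ∀ {u v} → comp′ u ≡ comp′ v → Star (AdjIn (e ∷ es)) u v
  walk′ eq with identify-cases x y eq
  ... | inj₁ u~v                = walk⁺ u~v
  ... | inj₂ (inj₁ (u~hi , v~lo)) = walk⁺ u~hi ◅◅ here (inj₂ (refl , refl)) ◅ walk⁺ (sym v~lo)
  ... | inj₂ (inj₂ (u~lo , v~hi)) = walk⁺ u~lo ◅◅ here (inj₁ (refl , refl)) ◅ walk⁺ (sym v~hi)

-- Simple paths by loop erasure

module _ {A : Set} {R : Rel A 0ℓ} where

  -- The list holds the vertices of the path after its first one.
  data Path : A → List A → A → Set where
    []  : ∀ {u} → Path u [] u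
    _∷_ : ∀ {u w ws v} → R u w → Path w ws v → Path u (w ∷ ws) v

  SimplePath : A → A → Set
  SimplePath u v = ∃[ ws ] (Path u ws v × Unique (u ∷ ws))

  suffixFrom : ∀ {u w ws v} → u ∈ (w ∷ ws) → Path w ws v → Unique (w ∷ ws) → SimplePath u v
  suffixFrom (here refl) p       unq       = _ , p , unq
  suffixFrom (there u∈)  (_ ∷ p) (_ ∷ unq) = suffixFrom u∈ p unq

  -- If the new first vertex already occurs on the simple path from its successor, the path is cut
  -- back to that occurrence.
  eraseLoops : DecidableEquality A → ∀ {u v} → Star R u v → SimplePath u v
  eraseLoops _≟_ ε = [] , [] , [] ∷ []
  eraseLoops _≟_ {u} (_◅_ {j = w} r s) with ws , p , unq ← eraseLoops _≟_ s
    with DecMembership._∈?_ _≟_ u (w ∷ ws)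
  ... | yes u∈ = suffixFrom u∈ p unq
  ... | no u∉  = w ∷ ws , r ∷ p , ¬Any⇒All¬ (w ∷ ws) u∉ ∷ unq

  path-step : ∀ {u ws v} → Path u ws v → ∀ i → R (lookup (u ∷ ws) (inject₁ i)) (lookup ws i)
  path-step (r ∷ p) zero    = r
  path-step (r ∷ p) (suc i) = path-step p i

  path-end : ∀ {u ws v} → Path u ws v → lookup (u ∷ ws) (fromℕ (length ws)) ≡ v
  path-end []      = refl
  path-end (_ ∷ p) = path-end p

unique-lookup-injective : ∀ {A : Set} {xs : List A} → Unique xs → Injective _≡_ _≡_ (lookup xs)
unique-lookup-injective (x∉ ∷ unq) {zero}  {zero}  _  = refl
unique-lookup-injective {xs = _ ∷ xs} (x∉ ∷ unq) {zero}  {suc j} eq =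
  contradiction eq (All.lookup x∉ (∈-lookup j))
unique-lookup-injective {xs = _ ∷ xs} (x∉ ∷ unq) {suc i} {zero}  eq =
  contradiction (sym eq) (All.lookup x∉ (∈-lookup i))
unique-lookup-injective (x∉ ∷ unq) {suc i} {suc j} eq =
  cong suc (unique-lookup-injective unq eq)

adjacent : ∀ {n} {G : EdgeOrderedGraph n} {u v} → AdjIn (edges G) u v → Adj G u v
adjacent uv = Any.index uv , Any.lookup-index uv

-- A simple path of length zero would identify the ends of `e`, one of length one would repeat `e`
-- in `es`, and a longer one closes up with `e` to a cycle.
no-detour : ∀ {n} {e : Edge n} {es} (unq : Unique (e ∷ es)) → Acyclic (graph (e ∷ es) unq) →
            ¬ Star (AdjIn es) (lo e) (hi e)
no-detour {e = e} {es} unq@(e∉es ∷ _) acyclic walk with eraseLoops Fin._≟_ walk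
... | [] , p , _ = lo≢hi e (path-end p)
... | _ ∷ [] , ef ∷ [] , _ with f , f∈es , joins ← find ef =
  All.lookup e∉es f∈es (same joins)
  where
  same : ∀ {f} → Joins f (lo e) (hi e) → e ≡ f
  same (inj₁ (p , q)) = edge-≡ (sym p) (sym q)
  same {f} (inj₂ (p , q)) = contradiction (sym p) (not-reversed e f (sym q))
... | ws@(_ ∷ _ ∷ zs) , p , simple = acyclic (length zs , lookup (lo e ∷ ws) ,
  unique-lookup-injective simple ,
  (λ i → adjacent {G = graph (e ∷ es) unq} (there (path-step p i))) ,
  -- The closing edge is `e` itself, at label zero, traversed from `hi e` back to `lo e`.
  (zero , inj₂ (refl , sym (path-end p))))

-- The true side is the component of `lo e` once `e` is removed; a tree offers no detour by which
-- `hi e` could belong to it.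
separation : ∀ {n} {e : Edge n} {es} (unq : Unique (e ∷ es)) → Acyclic (graph (e ∷ es) unq) →
  ∃[ side ] (side (lo e) ≡ true × side (hi e) ≡ false × All (λ f → side (lo f) ≡ side (hi f)) es)
separation {e = e} {es} unq acyclic with comp , ok , walk ← components es
  = (λ w → does (comp w Fin.≟ comp (lo e))) ,
    dec-true (comp (lo e) Fin.≟ comp (lo e)) refl ,
    dec-false (comp (hi e) Fin.≟ comp (lo e)) (no-detour unq acyclic ∘ walk ∘ sym) ,
    All.map (cong (λ c → does (c Fin.≟ comp (lo e)))) ok

-- Contracting an edge of a tree

module Contraction {t} (e₁ : Edge (suc t)) {es : List (Edge (suc t))} (unq : Unique es)
  (side : Fin (suc t) → Bool) (side-lo : side (lo e₁) ≡ true) (side-hi : side (hi e₁) ≡ false)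
  (one-sided : All (λ e → side (lo e) ≡ side (hi e)) es) where

  hi≢lo : hi e₁ ≢ lo e₁
  hi≢lo = lo≢hi e₁ ∘ sym

  -- After `hi e₁` is sent to `lo e₁`, its index is free and `punchOut` removes it. The lost vertex
  -- is what later keeps `T` out of a single fibre.
  contract : Fin (suc t) → Fin t
  contract w = punchOut (identify-≢ (hi e₁) (lo e₁) hi≢lo w)

  contract-ends : contract (lo e₁) ≡ contract (hi e₁)
  contract-ends = Fin.punchOut-cong (hi e₁)
    (≡.trans (identify-target (hi e₁) (lo e₁)) (sym (identify-source (hi e₁) (lo e₁))))

  end : Bool → Fin (suc t)
  end true  = lo e₁
  end false = hi e₁

  lo≁hi : side (lo e₁) ≢ side (hi e₁)
  lo≁hi same with () ← ≡.trans (sym side-lo) (≡.trans same side-hi)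

  -- Only the two ends of `e₁` are identified, and they lie on opposite sides, so a vertex confused
  -- with another is the end of `e₁` on its own side.
  contract-cases : ∀ {u v} → contract u ≡ contract v →
                   u ≡ v ⊎ (side u ≢ side v × u ≡ end (side u))
  contract-cases {u} {v} eq
    with identify-cases (hi e₁) (lo e₁)
           (Fin.punchOut-injective (identify-≢ (hi e₁) (lo e₁) hi≢lo u)
                                   (identify-≢ (hi e₁) (lo e₁) hi≢lo v) eq)
  ... | inj₁ u≡v = inj₁ u≡v
  ... | inj₂ (inj₁ (refl , refl)) = inj₂ (lo≁hi ∘ sym , cong end (sym side-hi))
  ... | inj₂ (inj₂ (refl , refl)) = inj₂ (lo≁hi , cong end (sym side-lo))

  contract-injective : ∀ {u v} → side u ≡ side v → contract u ≡ contract v → u ≡ v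
  contract-injective same eq with contract-cases eq
  ... | inj₁ u≡v             = u≡v
  ... | inj₂ (different , _) = contradiction same different

  ContractsTo : Edge (suc t) → Edge t → Set
  ContractsTo = JoinsVia contract

  OneSided : Edge (suc t) → Set
  OneSided e = side (lo e) ≡ side (hi e)

  contractsTo : ∀ e → OneSided e → ∃[ e′ ] ContractsTo e e′
  contractsTo e good = joining (lo≢hi e ∘ contract-injective good)

  -- Contraction is injective on each side, and edges from opposite sides can share only the
  -- contracted vertex. So no parallel edges arise and the contracted list is repetition-free.
  contractsTo-injective : ∀ {e f g} → OneSided e → OneSided f →
                          ContractsTo e g → ContractsTo f g → e ≡ f
  contractsTo-injective {e} {f} {g} ge gf eg fg = aligned {g} eg fg
    where
    -- If both ends of e were confused with vertices on the other side,
    -- both would be the end of e₁ on their common side.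
    straight : contract (lo e) ≡ contract (lo f) → contract (hi e) ≡ contract (hi f) → e ≡ f
    straight p q with contract-cases p | contract-cases q
    ... | inj₁ lo≡lo | inj₁ hi≡hi = edge-≡ lo≡lo hi≡hi
    ... | inj₁ lo≡lo | inj₂ (d , _) =
      contradiction (≡.trans (sym ge) (≡.trans (cong side lo≡lo) gf)) d
    ... | inj₂ (d , _) | inj₁ hi≡hi =
      contradiction (≡.trans ge (≡.trans (cong side hi≡hi) (sym gf))) d
    ... | inj₂ (_ , lo≡) | inj₂ (_ , hi≡) =
      contradiction (≡.trans lo≡ (≡.trans (cong end ge) (sym hi≡))) (lo≢hi e)

    crossed : contract (lo e) ≡ contract (hi f) → contract (hi e) ≡ contract (lo f) → e ≡ f
    crossed p q with contract-cases p | contract-cases q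
    ... | inj₁ lo≡hi | inj₁ hi≡lo =
      contradiction hi≡lo (not-reversed e f lo≡hi)
    ... | inj₁ lo≡hi | inj₂ (d , _) =
      contradiction (≡.trans (sym ge) (≡.trans (cong side lo≡hi) (sym gf))) d
    ... | inj₂ (d , _) | inj₁ hi≡lo =
      contradiction (≡.trans ge (≡.trans (cong side hi≡lo) gf)) d
    ... | inj₂ (_ , lo≡) | inj₂ (_ , hi≡) =
      contradiction (≡.trans lo≡ (≡.trans (cong end ge) (sym hi≡))) (lo≢hi e)

    aligned : ∀ {g} → ContractsTo e g → ContractsTo f g → e ≡ f
    aligned (inj₁ (p , q)) (inj₁ (r , s)) = straight (≡.trans (sym p) r) (≡.trans (sym q) s)
    aligned (inj₁ (p , q)) (inj₂ (r , s)) = crossed (≡.trans (sym p) r) (≡.trans (sym q) s)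
    aligned (inj₂ (p , q)) (inj₁ (r , s)) = crossed (≡.trans (sym q) s) (≡.trans (sym p) r)
    aligned (inj₂ (p , q)) (inj₂ (r , s)) = straight (≡.trans (sym q) s) (≡.trans (sym p) r)

  -- The pointwise relation records that contraction keeps the edge order.
  contractAll : ∀ {es} → Unique es → All OneSided es →
                ∃[ es′ ] (Unique es′ × Pointwise ContractsTo es es′)
  contractAll [] [] = [] , [] , []
  contractAll (_∷_ {x = e} e∉es unq) (good ∷ goods)
    with e′ , ee′ ← contractsTo e good
       | es′ , unq′ , contracted ← contractAll unq goods
    = e′ ∷ es′ , distinct {e} {e′} good ee′ e∉es goods contracted ∷ unq′ , ee′ ∷ contracted
    where
    distinct : ∀ {e e′ es es′} → OneSided e → ContractsTo e e′ → All (e ≢_) es →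
               All OneSided es → Pointwise ContractsTo es es′ → All (e′ ≢_) es′
    distinct ge ee′ [] [] [] = []
    distinct {e} {e′} ge ee′ (_∷_ {x = f} e≢f e∉es) (gf ∷ gs) (ff′ ∷ cs) =
      (λ { refl → e≢f (contractsTo-injective {e} {f} {e′} ge gf ee′ ff′) }) ∷
      distinct {e} {e′} ge ee′ e∉es gs cs

  contractedEdges : List (Edge t)
  contractedEdges = proj₁ (contractAll unq one-sided)

  contractedEdges-unique : Unique contractedEdges
  contractedEdges-unique = proj₁ (proj₂ (contractAll unq one-sided))

  contracted : Pointwise ContractsTo es contractedEdges
  contracted = proj₂ (proj₂ (contractAll unq one-sided))

  -- Three fibres joined by a triangle

  module Triangle {n} (3t≤n : 3 * t ≤ n) where

    root : Fin t
    root = contract (lo e₁)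

    -- Beyond this block only injectivity, monotonicity and the bound `3 * t` matter, so the
    -- arithmetic of the embedding stays opaque.
    abstract

      vertex : Fin 3 → Fin t → Fin n
      vertex c w = inject≤ (combine c w) 3t≤n

      vertex-injective : ∀ {c d v w} → vertex c v ≡ vertex d w → c ≡ d × v ≡ w
      vertex-injective {c} {d} {v} {w} eq =
        Fin.combine-injective c v d w (Fin.inject≤-injective 3t≤n 3t≤n _ _ eq)

      toℕ-vertex : ∀ c w → toℕ (vertex c w) ≡ toℕ (combine c w)
      toℕ-vertex c w = Fin.toℕ-inject≤ (combine c w) 3t≤n

      vertex<3t : ∀ c w → toℕ (vertex c w) ℕ.< 3 * t
      vertex<3t c w = subst (ℕ._< 3 * t) (sym (toℕ-vertex c w)) (Fin.toℕ<n (combine c w))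

      vertex-monoˡ-< : ∀ {c d} w → c Fin.< d → vertex c w Fin.< vertex d w
      vertex-monoˡ-< {c} {d} w c<d = subst₂ ℕ._<_ (sym (toℕ-vertex c w)) (sym (toℕ-vertex d w))
        (Fin.combine-monoˡ-< w w c<d)

      vertex-monoʳ-< : ∀ c {v w} → v Fin.< w → vertex c v Fin.< vertex c w
      vertex-monoʳ-< c {v} {w} v<w = subst₂ ℕ._<_ (offset v) (offset w)
        (ℕ.+-monoʳ-< (t * toℕ c) v<w)
        where
        offset : ∀ w → t * toℕ c + toℕ w ≡ toℕ (vertex c w)
        offset w = sym (≡.trans (toℕ-vertex c w) (Fin.toℕ-combine c w))

    triangleEdge : Edge 3 → Edge n
    triangleEdge (edge c d c<d) =
      edge (vertex c root) (vertex d root) (vertex-monoˡ-< root c<d)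

    fibreEdge : Edge t → Fin 3 → Edge n
    fibreEdge (edge v w v<w) c = edge (vertex c v) (vertex c w) (vertex-monoʳ-< c v<w)

    -- The three copies of one contracted edge are consecutive in `fibres`. Hence a copy of each
    -- edge may be chosen in any fibre, independently of the others, without disturbing the order of
    -- `es`.
    triangle fibres : List (Edge n)
    triangle = map triangleEdge (allEdges 3)
    fibres   = cartesianProductWith fibreEdge contractedEdges (allFin 3)

    triangleEdge-injective : ∀ {e f} → triangleEdge e ≡ triangleEdge f → e ≡ f
    triangleEdge-injective eq = edge-≡ (proj₁ (vertex-injective (cong lo eq)))
                                       (proj₁ (vertex-injective (cong hi eq)))

    fibreEdge-injective : ∀ {e f c d} → fibreEdge e c ≡ fibreEdge f d → e ≡ f × c ≡ d
    fibreEdge-injective eq with c≡d , lo≡lo ← vertex-injective (cong lo eq) =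
      edge-≡ lo≡lo (proj₂ (vertex-injective (cong hi eq))) , c≡d

    -- A triangle edge joins two different fibres, while a fibre edge stays in one.
    disjoint : ∀ {e} → ¬ (e ∈ triangle × e ∈ fibres)
    disjoint (e∈triangle , e∈fibres)
      with f , _ , refl ← ∈-map⁻ triangleEdge {xs = allEdges 3} e∈triangle
         | _ , c , _ , _ , eq ← ∈-cartesianProductWith⁻ fibreEdge contractedEdges (allFin 3) e∈fibres
      = lo≢hi f (≡.trans (proj₁ (vertex-injective (cong lo eq)))
                         (sym (proj₁ (vertex-injective (cong hi eq)))))

    host : EdgeOrderedGraph n
    host = graph (triangle ++ fibres)
      (Unique.++⁺ (Unique.map⁺ triangleEdge-injective (from-yes (DecUnique.unique? _≟ᴱ_ (allEdges 3))))
        (Unique.cartesianProductWith⁺ fibreEdge fibreEdge-injective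
          contractedEdges-unique (Unique.allFin⁺ 3))
        disjoint)

    size-host : size host ≤ 3 + length contractedEdges * 3
    size-host = s≤s (s≤s (s≤s (ℕ.≤-reflexive (length-fibres contractedEdges))))
      where
      length-fibres : ∀ as → length (cartesianProductWith fibreEdge as (allFin 3)) ≡ length as * 3
      length-fibres []       = refl
      length-fibres (_ ∷ as) = cong (3 +_) (length-fibres as)

    on-triangleEdge : ∀ {c e} → On c e → On (vertex c root) (triangleEdge e)
    on-triangleEdge (inj₁ refl) = inj₁ refl
    on-triangleEdge (inj₂ refl) = inj₂ refl

    triangle-meet : ∀ {e f} → e ∈ triangle → f ∈ triangle → Meet e f
    triangle-meet e∈ f∈
      with e′ , _ , refl ← ∈-map⁻ triangleEdge {xs = allEdges 3} e∈
         | f′ , _ , refl ← ∈-map⁻ triangleEdge {xs = allEdges 3} f∈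
      with c , on-e , on-f ← edges₃-meet e′ f′
      = vertex c root , on-triangleEdge {e = e′} on-e , on-triangleEdge {e = f′} on-f

    Fibre : Fin 3 → Fin n → Set
    Fibre c x = ∃[ w ] x ≡ vertex c w

    fibre-step : ∀ {e x y} → e ∈ fibres → Joins e x y → ∃[ c ] (Fibre c x × Fibre c y)
    fibre-step e∈ joins
      with _ , c , _ , _ , refl ← ∈-cartesianProductWith⁻ fibreEdge contractedEdges (allFin 3) e∈
      with joins
    ... | inj₁ (refl , refl) = c , (_ , refl) , (_ , refl)
    ... | inj₂ (refl , refl) = c , (_ , refl) , (_ , refl)

    -- Excluding `e₀+ T` from the host

    module _ (unq₁ : Unique (e₁ ∷ es)) where

      private
        T : EdgeOrderedGraph (suc t)
        T = graph (e₁ ∷ es) unq₁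

      -- Without the triangle a connected copy cannot leave its fibre, so `suc t` vertices would
      -- inject into `t` coordinates.
      fibres-free : Connected T → ∀ {f} → ¬ (fibres Hosts edges T via f)
      fibres-free conn {f} (f-inj , s) = ℕ.<-irrefl refl (Fin.injective⇒≤ coordinate-inj)
        where
        image : ∀ {u v} → Adj T u v → ∃[ c ] (Fibre c (f u) × Fibre c (f v))
        image (i , joins) = fibre-step (∈-lookup (position s i)) (transport joins)
          where
          e = edgeAt T i
          e′ = lookup fibres (position s i)
          transport : ∀ {u v} → Joins e u v → Joins e′ (f u) (f v)
          transport (inj₁ (refl , refl)) = position-related s i
          transport (inj₂ (refl , refl)) with position-related s i
          ... | inj₁ pq = inj₂ pq
          ... | inj₂ pq = inj₁ pq

        stays : ∀ {c u v} → Star (Adj T) u v → Fibre c (f u) → Fibre c (f v)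
        stays ε         in-c = in-c
        -- The fibre index found for the step must be the current one, because the vertex `f u`
        -- determines it.
        stays (uv ◅ vs) (w , fu≡) with d , (w′ , fu≡′) , in-d ← image uv
          with refl , _ ← vertex-injective (≡.trans (sym fu≡) fu≡′) = stays vs in-d

        home : ∃[ c ] Fibre c (f (lo e₁))
        home with c , in-c , _ ← image (zero , inj₁ (refl , refl)) = c , in-c

        coordinate : ∀ w → Fibre (proj₁ home) (f w)
        coordinate w = stays (conn (lo e₁) w) (proj₂ home)

        coordinate-inj : Injective _≡_ _≡_ (proj₁ ∘ coordinate)
        coordinate-inj {u} {v} eq = f-inj (≡.trans (proj₂ (coordinate u))
          (≡.trans (cong (vertex (proj₁ home)) eq) (sym (proj₂ (coordinate v)))))

      -- The triangle comes first in the order. If `e₁` lands in it, so does the earlier `e₀`, yet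
      -- triangle edges meet and these two are disjoint; otherwise all of `T` lies in the fibres.
      host-free : Connected T → ¬ (edges host Hosts edges (e₀+ T))
      -- `e₀` is dropped to locate `e₁` first; `early` then returns to the full embedding to locate
      -- `e₀`.
      host-free conn (g , g-inj , s) = late (splitHead triangle (∷ˡ⁻ s))
        where
        unshift : ∀ as {bs} → Sublist (JoinsVia g) (map shiftEdge as) bs →
                  Sublist (JoinsVia (g ∘ (2 ↑ʳ_))) as bs
        unshift []       s        = minimum _
        unshift (a ∷ as) (b ∷ʳ s) = b ∷ʳ unshift (a ∷ as) s
        unshift (a ∷ as) (r ∷ s)  = r ∷ unshift as s

        inside-fibres : ¬ Sublist (JoinsVia g) (map shiftEdge (edges T)) fibres
        inside-fibres s′ = fibres-free conn {g ∘ (2 ↑ʳ_)}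
          ((λ eq → Fin.↑ʳ-injective 2 _ _ (g-inj eq)) , unshift (edges T) s′)

        meeting : Any (JoinsVia g e₀) triangle → ¬ Any (JoinsVia g (shiftEdge e₁)) triangle
        meeting at-e₀ at-e₁
          with e , e∈ , e-joins ← find at-e₀ | f , f∈ , f-joins ← find at-e₁
          with x , on-e , on-f ← triangle-meet e∈ f∈
          with on-joined {e = e} e-joins on-e | on-joined {e = f} f-joins on-f
        ... | inj₁ refl | inj₁ eq = contradiction (g-inj eq) λ ()
        ... | inj₁ refl | inj₂ eq = contradiction (g-inj eq) λ ()
        ... | inj₂ refl | inj₁ eq = contradiction (g-inj eq) λ ()
        ... | inj₂ refl | inj₂ eq = contradiction (g-inj eq) λ ()

        early : Any (JoinsVia g (shiftEdge e₁)) triangle →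
                ¬ (Any (JoinsVia g e₀) triangle ⊎ Sublist (JoinsVia g) (edges (e₀+ T)) fibres)
        early at-e₁ (inj₁ at-e₀) = meeting at-e₀ at-e₁
        early at-e₁ (inj₂ s′)    = inside-fibres (∷ˡ⁻ s′)

        late : ¬ (Any (JoinsVia g (shiftEdge e₁)) triangle ⊎
                  Sublist (JoinsVia g) (map shiftEdge (edges T)) fibres)
        late (inj₁ at-e₁) = early at-e₁ (splitHead triangle s)
        late (inj₂ s′)    = inside-fibres s′

      -- Copies of `T` that miss a given fibre

      opposite : Fin 3 → Edge 3
      opposite zero             = edge (suc zero) (suc (suc zero)) (s≤s (s≤s z≤n))
      opposite (suc zero)       = edge zero (suc (suc zero)) (s≤s z≤n)
      opposite (suc (suc zero)) = edge zero (suc zero) (s≤s z≤n)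

      opposite-off : ∀ c → ¬ On c (opposite c)
      opposite-off zero             = λ { (inj₁ ()) ; (inj₂ ()) }
      opposite-off (suc zero)       = λ { (inj₁ ()) ; (inj₂ ()) }
      opposite-off (suc (suc zero)) = λ { (inj₁ ()) ; (inj₂ ()) }

      -- The copy of T that starts with a given edge of the triangle
      -- continues, on each side of e₁, in the fibre of the corresponding end.
      module _ (d : Edge 3) where

        fibreOf : Bool → Fin 3
        fibreOf true  = lo d
        fibreOf false = hi d

        fibreOf-injective : Injective _≡_ _≡_ fibreOf
        fibreOf-injective {true}  {true}  _  = refl
        fibreOf-injective {true}  {false} eq = contradiction eq (lo≢hi d)
        fibreOf-injective {false} {true}  eq = contradiction (sym eq) (lo≢hi d)
        fibreOf-injective {false} {false} _  = refl

        place : Fin (suc t) → Fin n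
        place w = vertex (fibreOf (side w)) (contract w)

        -- The two sides go to different fibres, and contraction is injective on each side.
        place-injective : Injective _≡_ _≡_ place
        place-injective eq with same , eq′ ← vertex-injective eq =
          contract-injective (fibreOf-injective same) eq′

        -- Both ends of `e₁` contract to `root`, and their sides send them to the fibres of the two
        -- ends of `d`.
        placed-head : JoinsVia place e₁ (triangleEdge d)
        placed-head = inj₁ (lo-placed , hi-placed)
          where
          lo-placed : vertex (lo d) root ≡ place (lo e₁)
          lo-placed = cong (λ b → vertex (fibreOf b) root) (sym side-lo)

          hi-placed : vertex (hi d) root ≡ place (hi e₁)
          hi-placed = cong₂ vertex (cong fibreOf (sym side-hi)) contract-ends

        placed-edge : ∀ {e e′} → OneSided e → ContractsTo e e′ →
                      JoinsVia place e (fibreEdge e′ (fibreOf (side (lo e))))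
        placed-edge {e} good (inj₁ (refl , refl)) =
          inj₁ (refl , cong (λ b → vertex (fibreOf b) (contract (hi e))) good)
        placed-edge {e} good (inj₂ (refl , refl)) =
          inj₂ (cong (λ b → vertex (fibreOf b) (contract (hi e))) good , refl)

        -- From each block of three copies, the one in the fibre assigned to the edge's side is
        -- taken.
        placed-tail : ∀ {as as′} → All OneSided as → Pointwise ContractsTo as as′ →
                      Sublist (JoinsVia place) as (cartesianProductWith fibreEdge as′ (allFin 3))
        placed-tail []           []           = []
        placed-tail (_∷_ {x = e} good gs) (_∷_ {y = e′} c cs) =
          ++⁺ (fromAny (lose (∈-map⁺ (fibreEdge e′) (∈-allFin _)) (placed-edge {e} {e′} good c)))
              (placed-tail gs cs)

        placed : edges host Hosts edges T via place
        placed = place-injective ,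
          ++⁺ (fromAny (lose (∈-map⁺ triangleEdge (∈-allEdges d)) placed-head))
              (placed-tail one-sided contracted)

      avoiding : ∀ v → ∃[ c ] (∀ d w → d ≢ c → vertex d w ≢ v)
      avoiding v with Fin.any? (λ c → Fin.any? (λ w → vertex c w Fin.≟ v))
      ... | yes (c , _ , refl) = c , λ d w d≢c eq → d≢c (proj₁ (vertex-injective eq))
      -- A vertex outside all fibres is avoided in any case, so the index is arbitrary.
      ... | no outside         = zero , λ d w _ eq → outside (d , w , eq)

      core : Connected T → RobustCore T (3 * t) n
      core conn = record
        { host   = host
        ; free   = host-free conn
        -- The copy starting with the triangle edge opposite to the fibre of `v` uses only the other
        -- two fibres.
        ; robust = λ v → let c , avoids = avoiding v in
            place (opposite c) , placed (opposite c) , (λ w → vertex<3t _ (contract w)) ,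
            λ w → avoids _ (contract w) (fibreOf-off c (side w))
        }
        where
        fibreOf-off : ∀ c b → fibreOf (opposite c) b ≢ c
        fibreOf-off c true  eq = opposite-off c (inj₁ eq)
        fibreOf-off c false eq = opposite-off c (inj₂ eq)

-- A connected graph without edges has at most one vertex, so every constant map is a copy of it,
-- and of two vertices one always differs from `v`. The empty host cannot accommodate `e₀`.
edgelessCore : ∀ {t n} (unq : Unique {A = Edge t} []) → Connected (graph [] unq) → 2 ≤ n →
               Σ[ core ∈ RobustCore (graph [] unq) 2 n ] size (RobustCore.host core) ≤ 0
edgelessCore {t} unq conn (s≤s (s≤s {n = n} _)) = record
  { host   = graph [] []
  ; free   = λ { (_ , _ , ()) }
  ; robust = λ v → (λ _ → other v) , ((λ _ → subsingleton (conn _ _)) , []) ,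
                   (λ _ → other<2 v) , (λ _ → other≢ v)
  } , z≤n
  where
  subsingleton : ∀ {u v} → Star (Adj (graph [] unq)) u v → u ≡ v
  subsingleton ε = refl
  subsingleton ((() , _) ◅ _)

  other : Fin (2 + n) → Fin (2 + n)
  other zero    = suc zero
  other (suc _) = zero

  other<2 : ∀ v → toℕ (other v) ℕ.< 2
  other<2 zero    = s≤s (s≤s z≤n)
  other<2 (suc _) = s≤s z≤n

  other≢ : ∀ v → other v ≢ v
  other≢ zero    ()
  other≢ (suc _) ()

corollary40 : ∀ {t : ℕ} (T : EdgeOrderedGraph t) → IsTree T →
    ∃[ C ] ∃[ N ] (∀ (n : ℕ) → N ≤ n → ∃[ k ] (IsSatₘ n (e₀+ T) k × k ≤ C))
corollary40 T@(graph [] unq) (_ , conn , _) =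
  satₘ-bounded T 2 0 λ n → edgelessCore unq conn
corollary40 {suc t} T@(graph (e₁ ∷ es) unq@(_ ∷ unq-es)) (_ , conn , acyclic)
  with side , side-lo , side-hi , one-sided ← separation unq acyclic
  -- The three fibres have `t` vertices each. The edge bound counts the triangle and three copies of
  -- every contracted edge, so both constants depend on `T` alone.
  = satₘ-bounded T (3 * t) (3 + length contractedEdges * 3) λ n 3t≤n →
      let open Triangle 3t≤n in core unq conn , size-host
  where open Contraction e₁ unq-es side side-lo side-hi one-sided
corollary40 {zero} (graph (edge () _ _ ∷ _) _) _
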